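{- Let $\mathbf u$ be a uniformly recurrent infinite word over a finite alphabet whose language is closed under reversal. Then $$2D(\mathbf u)=\sum_{n=0}^{+\infty}T_{\mathbf u}(n),$$ where both sides may equal $+\infty$.
   Context: An infinite word $\mathbf u=u_0u_1u_2\ldots$ is over a finite alphabet $\mathcal A$. Its language $\mathcal L(\mathbf u)$ is the set of its finite factors; $\mathcal L_n(\mathbf u)$ is the set of factors of length $n$. The reversal of $w=w_0\ldots w_{n-1}$ is $\overline w=w_{n-1}\ldots w_0$; $w$ is a palindrome if $w=\overline w$ (the empty word is a palindrome). The language is closed under reversal if $w\in\mathcal L(\mathbf u)$ implies $\overline w\in\mathcal L(\mathbf u)$. $\mathbf u$ is uniformly recurrent if every factor occurs infinitely often and has only finitely many return words (equivalently, for every $n$ there is $R$ such that every factor of length at least $R$ contains all factors of length $n$). Factor complexity: $\mathcal C_{\mathbf u}(n)=\#\mathcal L_n(\mathbf u)$; palindromic complexity: $\mathcal P_{\mathbf u}(n)$ is the number of palindromes in $\mathcal L_n(\mathbf u)$. Define $T_{\mathbf u}(n)=\mathcal C_{\mathbf u}(n+1)-\mathcal C_{\mathbf u}(n)+2-\mathcal P_{\mathbf u}(n+1)-\mathcal P_{\mathbf u}(n)$ (for words with language closed under reversal this is always $\ge 0$). The defect of a finite word $w$ is $D(w)=|w|+1-(\text{number of distinct palindromic factors of } w\text{, including the empty word})$. The defect of an infinite word is $D(\mathbf u)=\sup\{D(w): w\text{ a prefix of }\mathbf u\}\in\mathbb N\cup\{+\infty\}$. -}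

module Defs where

open import Data.Nat using (ℕ; zero; suc; _+_; _≤_)
open import Data.Fin using (Fin)
open import Data.List using (List; []; _∷_; _++_; length; reverse)
open import Data.List.Membership.Propositional using (_∈_)
open import Data.List.Relation.Unary.Unique.Propositional using (Unique)
open import Data.Integer as ℤ using (ℤ; +_)
open import Data.Product using (Σ; ∃; ∃-syntax; _×_)
open import Function.Bundles using (_⇔_)
open import Relation.Binary.PropositionalEquality using (_≡_)

Word : ℕ → Set
Word k = ℕ → Fin k

factor : ∀ {k} → Word k → ℕ → ℕ → List (Fin k)
factor u i zero    = []
factor u i (suc n) = u i ∷ factor u (suc i) n

prefix : ∀ {k} → Word k → ℕ → List (Fin k)
prefix u n = factor u 0 n

_∈L_ : ∀ {k} → List (Fin k) → Word k → Set
w ∈L u = ∃[ i ] factor u i (length w) ≡ w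

IsPalindrome : ∀ {A : Set} → List A → Set
IsPalindrome w = reverse w ≡ w

FactorOf : ∀ {A : Set} → List A → List A → Set
FactorOf {A} v w = Σ (List A) λ xs → Σ (List A) λ ys → xs ++ v ++ ys ≡ w

IsCount : ∀ {A : Set} → (A → Set) → ℕ → Set
IsCount {A} P c = Σ (List A) λ xs → length xs ≡ c × Unique xs × (∀ x → (x ∈ xs) ⇔ P x)

ClosedUnderReversal : ∀ {k} → Word k → Set
ClosedUnderReversal u = ∀ w → w ∈L u → reverse w ∈L u

UniformlyRecurrent : ∀ {k} → Word k → Set
UniformlyRecurrent u =
  ∀ n → ∃[ R ] ∀ i → ∀ w → length w ≡ n → w ∈L u →
    ∃[ j ] (j + n ≤ R × factor u (i + j) n ≡ w)

IsFactorComplexity : ∀ {k} → Word k → (ℕ → ℕ) → Set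
IsFactorComplexity u C = ∀ n → IsCount (λ w → length w ≡ n × w ∈L u) (C n)

IsPalindromicComplexity : ∀ {k} → Word k → (ℕ → ℕ) → Set
IsPalindromicComplexity u P =
  ∀ n → IsCount (λ w → length w ≡ n × IsPalindrome w × w ∈L u) (P n)

IsPrefixPalCount : ∀ {k} → Word k → (ℕ → ℕ) → Set
IsPrefixPalCount u Q = ∀ m → IsCount (λ w → IsPalindrome w × FactorOf w (prefix u m)) (Q m)

T : (ℕ → ℕ) → (ℕ → ℕ) → ℕ → ℤ
T C P n = (((+ C (suc n) ℤ.- + C n) ℤ.+ + 2) ℤ.- + P (suc n)) ℤ.- + P n

prefixDefect : (ℕ → ℕ) → ℕ → ℤ
prefixDefect Q m = + (suc m) ℤ.- + Q m

partialSum : (ℕ → ℤ) → ℕ → ℤ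
partialSum f zero    = + 0
partialSum f (suc N) = partialSum f N ℤ.+ f N

{-# OPTIONS --safe #-}
-- Summing up, Σ_{n<N} T(n) = C(N) + P(N) + 2N − 2 Π(N), where Π(N) counts the palindromic factors
-- of length at most N.  Call a position j fresh if neither the length-N window at j nor its
-- reversal starts at an earlier position; closure under reversal gives C(N) + P(N) = 2 #fresh.
-- Distinct palindromes end their first occurrences at distinct positions e.  If e ≥ N, the window
-- ending at e is fresh when the palindrome has length at most N (else the palindrome would have
-- occurred before), and not fresh when it is longer (its prefix of length N is the reversal of
-- that window).  So at most #fresh palindromes of length at most N are missing from the prefix of
-- length N − 1, which gives 2 D(prefix of length N − 1) ≤ Σ_{n<N} T(n); and a prefix containing
-- all of L_N has at most one palindrome longer than N per position that is not fresh, which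
-- bounds its defect from below by the same sum.
module Submission where

open import Defs
open import Data.Fin using (Fin)
import Data.Fin.Properties as Fin
open import Data.Nat as ℕ using (ℕ; zero; suc; z≤n; s≤s)
import Data.Nat.Properties as ℕ
open import Data.Nat.Induction using (<-rec)
import Data.Nat.Tactic.RingSolver as ℕ-Solver
open import Data.Integer as ℤ using (+_; _*_; _≤_; +≤+)
import Data.Integer.Properties as ℤ
import Data.Integer.Tactic.RingSolver as ℤ-Solver
open import Data.List using (List; []; _∷_; _++_; length; map; reverse)
open import Data.List.Properties using (≡-dec; ∷-injective; length-++; length-++-sucʳ; length-map; length-reverse; reverse-++; reverse-involutive)
open import Data.List.Membership.Propositional using (_∈_; _∉_)
open import Data.List.Membership.Propositional.Properties using (∈-∃++; ∈-++⁺ˡ; ∈-++⁺ʳ; ∈-++⁻; ∈-map⁺)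
import Data.List.Membership.DecPropositional as DecMembership
open import Data.List.Relation.Unary.All as All using (All)
open import Data.List.Relation.Unary.AllPairs using ([]; _∷_)
open import Data.List.Relation.Unary.Any using (here; there)
open import Data.List.Relation.Unary.Unique.Propositional using (Unique)
import Data.List.Relation.Unary.Unique.Propositional.Properties as Unique
open import Data.Product using (∃; ∃-syntax; _×_; _,_; proj₁; proj₂)
open import Data.Sum as Sum using (_⊎_; inj₁; inj₂; [_,_]′)
open import Function.Base using (_∘_)
open import Function.Bundles using (_⇔_; mk⇔; Equivalence)
open import Relation.Nullary using (¬_; Dec; yes; no; contradiction)
open import Relation.Binary.Definitions using (DecidableEquality)
open import Relation.Binary.PropositionalEquality using (_≡_; _≢_; refl; sym; trans; cong; cong₂; subst; subst₂; module ≡-Reasoning)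

-- Counting with duplicate-free lists.

∉⇒All-≢ : ∀ {A : Set} {x : A} {xs} → x ∉ xs → All (x ≢_) xs
∉⇒All-≢ x∉xs = All.tabulate λ y∈xs x≡y → x∉xs (subst (_∈ _) (sym x≡y) y∈xs)

-- Pigeonhole by induction on `xs`: the partner of the head is deleted from `ys`, and no later
-- element loses its partner by this, since `inj` would make it equal to the head.
length-≤-via : ∀ {A B : Set} (R : A → B → Set) → (∀ {x x′ y} → R x y → R x′ y → x ≡ x′) →
  ∀ {xs} ys → Unique xs → (∀ {x} → x ∈ xs → ∃[ y ] (y ∈ ys × R x y)) → length xs ℕ.≤ length ys
length-≤-via R inj ys [] cover = z≤n
length-≤-via R inj {x ∷ xs} ys (x≢xs ∷ uniq) cover with cover (here refl)
... | y , y∈ys , Rxy with ∈-∃++ y∈ys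
... | ls , rs , refl = subst (suc (length xs) ℕ.≤_) (sym (length-++-sucʳ ls y rs))
    (s≤s (length-≤-via R inj (ls ++ rs) uniq cover′))
  where
  cover′ : ∀ {z} → z ∈ xs → ∃[ y′ ] (y′ ∈ ls ++ rs × R z y′)
  cover′ z∈xs with cover (there z∈xs)
  ... | y′ , y′∈ , Rzy′ with ∈-++⁻ ls y′∈
  ...   | inj₁ y′∈ls         = y′ , ∈-++⁺ˡ y′∈ls , Rzy′
  ...   | inj₂ (there y′∈rs) = y′ , ∈-++⁺ʳ ls y′∈rs , Rzy′
  ...   | inj₂ (here refl)   = contradiction (inj Rxy Rzy′) (All.lookup x≢xs z∈xs)

Unique-⊆⇒length-≤ : ∀ {A : Set} {xs : List A} ys → Unique xs → (∀ {x} → x ∈ xs → x ∈ ys) →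
  length xs ℕ.≤ length ys
Unique-⊆⇒length-≤ ys uniq xs⊆ys =
  length-≤-via _≡_ (λ p q → trans p (sym q)) ys uniq (λ x∈xs → _ , xs⊆ys x∈xs , refl)

IsCount-≥ : ∀ {A : Set} {P : A → Set} {p xs} → IsCount P p → Unique xs →
  (∀ {x} → x ∈ xs → P x) → length xs ℕ.≤ p
IsCount-≥ (ys , refl , _ , ys⇔) uniq xs⊆P =
  Unique-⊆⇒length-≤ ys uniq (λ x∈xs → Equivalence.from (ys⇔ _) (xs⊆P x∈xs))

IsCount-≤ : ∀ {A : Set} {P : A → Set} {p} xs → IsCount P p → (∀ {x} → P x → x ∈ xs) →
  p ℕ.≤ length xs
IsCount-≤ xs (ys , refl , uniq , ys⇔) P⊆xs =
  Unique-⊆⇒length-≤ xs uniq (λ y∈ys → P⊆xs (Equivalence.to (ys⇔ _) y∈ys))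

IsCount-mono : ∀ {A : Set} {P Q : A → Set} {p q} → IsCount P p → IsCount Q q →
  (∀ {x} → P x → Q x) → p ℕ.≤ q
IsCount-mono (xs , refl , uniq , xs⇔) countQ P⇒Q =
  IsCount-≥ countQ uniq (λ x∈xs → P⇒Q (Equivalence.to (xs⇔ _) x∈xs))

IsCount-⊎ : ∀ {A : Set} {P Q : A → Set} {p q} → IsCount P p → IsCount Q q →
  (∀ {x} → P x → ¬ Q x) → IsCount (λ x → P x ⊎ Q x) (p ℕ.+ q)
IsCount-⊎ (xs , refl , uniq , xs⇔) (ys , refl , uniq′ , ys⇔) disjoint =
  xs ++ ys , length-++ xs ,
  Unique.++⁺ uniq uniq′
    (λ { {x} (x∈xs , x∈ys) → disjoint (Equivalence.to (xs⇔ x) x∈xs) (Equivalence.to (ys⇔ x) x∈ys) }) ,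
  λ x → mk⇔
    (λ x∈ → Sum.map (Equivalence.to (xs⇔ x)) (Equivalence.to (ys⇔ x)) (∈-++⁻ xs x∈))
    [ (λ Px → ∈-++⁺ˡ (Equivalence.from (xs⇔ x) Px))
    , (λ Qx → ∈-++⁺ʳ xs (Equivalence.from (ys⇔ x) Qx)) ]′

IsCount-cong : ∀ {A : Set} {P Q : A → Set} {p} → (∀ {x} → P x → Q x) → (∀ {x} → Q x → P x) →
  IsCount P p → IsCount Q p
IsCount-cong P⇒Q Q⇒P (xs , len , uniq , xs⇔) = xs , len , uniq ,
  λ x → mk⇔ (P⇒Q ∘ Equivalence.to (xs⇔ x)) (Equivalence.from (xs⇔ x) ∘ Q⇒P)

-- Splitting concatenations, least numbers and common bounds.

++-injective : ∀ {A : Set} (xs ys : List A) {us vs} → length xs ≡ length ys →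
  xs ++ us ≡ ys ++ vs → xs ≡ ys × us ≡ vs
++-injective []       []       _   eq = refl , eq
++-injective (x ∷ xs) (y ∷ ys) len eq =
  let x≡y , eq′ = ∷-injective eq
      xs≡ys , us≡vs = ++-injective xs ys (ℕ.suc-injective len) eq′
  in cong₂ _∷_ x≡y xs≡ys , us≡vs

Least : (ℕ → Set) → ℕ → Set
Least P m = P m × (∀ {j} → j ℕ.< m → ¬ P j)

least : ∀ {P : ℕ → Set} → (∀ n → Dec (P n)) → ∀ n → P n → ∃ (Least P)
least {P} P? = <-rec (λ n → P n → ∃ (Least P)) step
  where
  step : ∀ n → (∀ {i} → i ℕ.< n → P i → ∃ (Least P)) → P n → ∃ (Least P)
  step n rec Pn with ℕ.anyUpTo? P? n
  ... | yes (i , i<n , Pi) = rec i<n Pi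
  ... | no ¬P<n            = n , Pn , λ j<n Pj → ¬P<n (_ , j<n , Pj)

commonBound : ∀ {A : Set} (R : A → ℕ → Set) xs → (∀ {x} → x ∈ xs → ∃ (R x)) →
  ∃[ M ] (∀ {x} → x ∈ xs → ∃[ n ] (n ℕ.< M × R x n))
commonBound R []       has = 0 , λ ()
commonBound R (x ∷ xs) has with has (here refl) | commonBound R xs (has ∘ there)
... | n , Rxn | M , bound = suc n ℕ.+ M , λ
  { (here refl)  → n , ℕ.m≤m+n (suc n) M , Rxn
  ; (there x∈xs) → let n′ , n′<M , Rxn′ = bound x∈xs
                   in n′ , ℕ.≤-trans n′<M (ℕ.m≤n+m M (suc n)) , Rxn′ }

<-suc-split : ∀ {m n} → m ℕ.< suc n → m ℕ.< n ⊎ m ≡ n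
<-suc-split m<1+n = ℕ.m≤n⇒m<n∨m≡n (ℕ.s≤s⁻¹ m<1+n)

-- Orbits of an involution met along a sequence.

module Orbits {A : Set} (_≟_ : DecidableEquality A) (ι : A → A) (ιι : ∀ x → ι (ι x) ≡ x)
  (f : ℕ → A) where

  open DecMembership _≟_ using (_∈?_)

  Stale : ℕ → Set
  Stale j = ∃[ i ] (i ℕ.< j × (f j ≡ f i ⊎ f j ≡ ι (f i)))

  -- Result of scanning `f` below `M`: `orbits` is the closure under `ι` of the values met, `fixed`
  -- its set of fixed points. A new orbit of size two adds two elements to `orbits` and none to
  -- `fixed`, one of size one adds one to each, so every fresh position contributes exactly two, as
  -- in Burnside's lemma.
  record Census (M : ℕ) : Set where
    field
      fresh stale      : List ℕ
      orbits fixed     : List A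
      fresh+stale      : length fresh ℕ.+ length stale ≡ M
      orbits+fixed     : length orbits ℕ.+ length fixed ≡ 2 ℕ.* length fresh
      orbits-unique    : Unique orbits
      fixed-unique     : Unique fixed
      orbits-sound     : ∀ {x} → x ∈ orbits → ∃[ i ] (i ℕ.< M × (x ≡ f i ⊎ x ≡ ι (f i)))
      fixed-sound      : ∀ {x} → x ∈ fixed → ι x ≡ x × x ∈ orbits
      orbits-complete  : ∀ {i} → i ℕ.< M → f i ∈ orbits
      orbits-completeι : ∀ {i} → i ℕ.< M → ι (f i) ∈ orbits
      fixed-complete   : ∀ {i} → i ℕ.< M → ι (f i) ≡ f i → f i ∈ fixed
      fresh-complete   : ∀ {i} → i ℕ.< M → ¬ Stale i → i ∈ fresh
      stale-complete   : ∀ {i} → i ℕ.< M → Stale i → i ∈ stale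

    orbits-closed : ∀ {x} → x ∈ orbits → ι x ∈ orbits
    orbits-closed x∈ with orbits-sound x∈
    ... | i , i<M , inj₁ refl = orbits-completeι i<M
    ... | i , i<M , inj₂ refl = subst (_∈ orbits) (sym (ιι (f i))) (orbits-complete i<M)

    fixed-of-orbits : ∀ {x} → x ∈ orbits → ι x ≡ x → x ∈ fixed
    fixed-of-orbits x∈ ιx≡x with orbits-sound x∈
    ... | i , i<M , inj₁ refl = fixed-complete i<M ιx≡x
    ... | i , i<M , inj₂ refl =
      let fi≡ιfi = trans (sym (ιι (f i))) ιx≡x
      in subst (_∈ fixed) fi≡ιfi (fixed-complete i<M (sym fi≡ιfi))

    stale⇒∈ : Stale M → f M ∈ orbits
    stale⇒∈ (i , i<M , inj₁ eq) = subst (_∈ orbits) (sym eq) (orbits-complete i<M)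
    stale⇒∈ (i , i<M , inj₂ eq) = subst (_∈ orbits) (sym eq) (orbits-completeι i<M)

  extend : ∀ {P : ℕ → Set} {M} → (∀ {i} → i ℕ.< M → P i) → P M → ∀ {i} → i ℕ.< suc M → P i
  extend below at i<1+M with <-suc-split i<1+M
  ... | inj₁ i<M  = below i<M
  ... | inj₂ refl = at

  later : ∀ {M} {x : A} → ∃[ i ] (i ℕ.< M × (x ≡ f i ⊎ x ≡ ι (f i))) →
    ∃[ i ] (i ℕ.< suc M × (x ≡ f i ⊎ x ≡ ι (f i)))
  later (i , i<M , eq) = i , ℕ.m<n⇒m<1+n i<M , eq

  census : ∀ M → Census M
  census zero = record
    { fresh = [] ; stale = [] ; orbits = [] ; fixed = []
    ; fresh+stale = refl ; orbits+fixed = refl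
    ; orbits-unique = [] ; fixed-unique = []
    ; orbits-sound = λ () ; fixed-sound = λ ()
    ; orbits-complete = λ () ; orbits-completeι = λ () ; fixed-complete = λ ()
    ; fresh-complete = λ () ; stale-complete = λ () }
  -- Position `M` is stale exactly when `f M` already lies in `orbits`, so membership decides the
  -- first question; the second test finds the size of a new orbit.
  census (suc M) = step (f M ∈? orbits) (ι (f M) ≟ f M)
    where
    open Census (census M)

    step : Dec (f M ∈ orbits) → Dec (ι (f M) ≡ f M) → Census (suc M)
    step (yes fM∈) _ = record
      { fresh = fresh ; stale = M ∷ stale ; orbits = orbits ; fixed = fixed
      ; fresh+stale = trans (ℕ.+-suc _ _) (cong suc fresh+stale)
      ; orbits+fixed = orbits+fixed
      ; orbits-unique = orbits-unique ; fixed-unique = fixed-unique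
      ; orbits-sound = λ x∈ → later (orbits-sound x∈)
      ; fixed-sound = fixed-sound
      ; orbits-complete = extend orbits-complete fM∈
      ; orbits-completeι = extend orbits-completeι (orbits-closed fM∈)
      ; fixed-complete = extend {λ i → ι (f i) ≡ f i → f i ∈ fixed} fixed-complete
          (fixed-of-orbits fM∈)
      ; fresh-complete = extend {λ i → ¬ Stale i → i ∈ fresh} fresh-complete
          (λ ¬stale → contradiction (orbits-sound fM∈) ¬stale)
      ; stale-complete = extend {λ i → Stale i → i ∈ M ∷ stale}
          (λ i<M s → there (stale-complete i<M s)) (λ _ → here refl) }
    step (no fM∉) (yes ιfM≡fM) = record
      { fresh = M ∷ fresh ; stale = stale ; orbits = f M ∷ orbits ; fixed = f M ∷ fixed
      ; fresh+stale = cong suc fresh+stale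
      ; orbits+fixed = trans (cong suc (ℕ.+-suc _ _))
          (trans (cong (suc ∘ suc) orbits+fixed) (sym (ℕ.*-suc 2 (length fresh))))
      ; orbits-unique = ∉⇒All-≢ fM∉ ∷ orbits-unique
      ; fixed-unique = ∉⇒All-≢ (fM∉ ∘ proj₂ ∘ fixed-sound) ∷ fixed-unique
      ; orbits-sound = λ { (here eq) → M , ℕ.n<1+n M , inj₁ eq
                         ; (there x∈) → later (orbits-sound x∈) }
      ; fixed-sound = λ { (here refl) → ιfM≡fM , here refl
                        ; (there x∈) → let ιx≡x , x∈orbits = fixed-sound x∈
                                       in ιx≡x , there x∈orbits }
      ; orbits-complete = extend (there ∘ orbits-complete) (here refl)
      ; orbits-completeι = extend (there ∘ orbits-completeι) (here ιfM≡fM)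
      ; fixed-complete = extend {λ i → ι (f i) ≡ f i → f i ∈ f M ∷ fixed}
          (λ i<M eq → there (fixed-complete i<M eq)) (λ _ → here refl)
      ; fresh-complete = extend {λ i → ¬ Stale i → i ∈ M ∷ fresh}
          (λ i<M s → there (fresh-complete i<M s)) (λ _ → here refl)
      ; stale-complete = extend {λ i → Stale i → i ∈ stale} stale-complete
          (λ s → contradiction (stale⇒∈ s) fM∉) }
    step (no fM∉) (no ιfM≢fM) = record
      { fresh = M ∷ fresh ; stale = stale ; orbits = f M ∷ ι (f M) ∷ orbits ; fixed = fixed
      ; fresh+stale = cong suc fresh+stale
      ; orbits+fixed = trans (cong (suc ∘ suc) orbits+fixed) (sym (ℕ.*-suc 2 (length fresh)))
      ; orbits-unique = ((ιfM≢fM ∘ sym) All.∷ ∉⇒All-≢ fM∉) ∷ ∉⇒All-≢ ιfM∉ ∷ orbits-unique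
      ; fixed-unique = fixed-unique
      ; orbits-sound = λ { (here eq) → M , ℕ.n<1+n M , inj₁ eq
                         ; (there (here eq)) → M , ℕ.n<1+n M , inj₂ eq
                         ; (there (there x∈)) → later (orbits-sound x∈) }
      ; fixed-sound = λ x∈ → let ιx≡x , x∈orbits = fixed-sound x∈
                             in ιx≡x , there (there x∈orbits)
      ; orbits-complete = extend (there ∘ there ∘ orbits-complete) (here refl)
      ; orbits-completeι = extend (there ∘ there ∘ orbits-completeι) (there (here refl))
      ; fixed-complete = extend {λ i → ι (f i) ≡ f i → f i ∈ fixed} fixed-complete
          (λ eq → contradiction eq ιfM≢fM)
      ; fresh-complete = extend {λ i → ¬ Stale i → i ∈ M ∷ fresh}
          (λ i<M s → there (fresh-complete i<M s)) (λ _ → here refl)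
      ; stale-complete = extend {λ i → Stale i → i ∈ stale} stale-complete
          (λ s → contradiction (stale⇒∈ s) fM∉) }
      where
      ιfM∉ : ι (f M) ∉ orbits
      ιfM∉ ιfM∈ = fM∉ (subst (_∈ orbits) (ιι (f M)) (orbits-closed ιfM∈))

-- Factors of an infinite word.

module _ {k : ℕ} (u : Word k) where

  length-factor : ∀ i n → length (factor u i n) ≡ n
  length-factor i zero    = refl
  length-factor i (suc n) = cong suc (length-factor (suc i) n)

  factor-++ : ∀ i a b → factor u i (a ℕ.+ b) ≡ factor u i a ++ factor u (i ℕ.+ a) b
  factor-++ i zero    b = cong (λ j → factor u j b) (sym (ℕ.+-identityʳ i))
  factor-++ i (suc a) b = cong (u i ∷_) (trans (factor-++ (suc i) a b)
    (cong (λ j → factor u (suc i) a ++ factor u j b) (sym (ℕ.+-suc i a))))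

  factor-suffix : ∀ i j a b → factor u i (a ℕ.+ b) ≡ factor u j (a ℕ.+ b) →
    factor u (i ℕ.+ a) b ≡ factor u (j ℕ.+ a) b
  factor-suffix i j a b eq = proj₂ (++-injective (factor u i a) (factor u j a)
    (trans (length-factor i a) (sym (length-factor j a)))
    (trans (sym (factor-++ i a b)) (trans eq (factor-++ j a b))))

  -- Reversal carries the last `b` letters of one factor to the first `b` letters of the other. For
  -- `i = j` this relates the two ends of a palindrome.
  factor-mirror : ∀ i j a b → factor u j (a ℕ.+ b) ≡ reverse (factor u i (a ℕ.+ b)) →
    factor u j b ≡ reverse (factor u (i ℕ.+ a) b)
  factor-mirror i j a b eq = proj₁ (++-injective (factor u j b) (reverse (factor u (i ℕ.+ a) b))
    (trans (length-factor j b) (sym (trans (length-reverse (factor u (i ℕ.+ a) b)) (length-factor _ b))))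
    (begin
      factor u j b ++ factor u (j ℕ.+ b) a             ≡⟨ factor-++ j b a ⟨
      factor u j (b ℕ.+ a)                             ≡⟨ cong (factor u j) (ℕ.+-comm b a) ⟩
      factor u j (a ℕ.+ b)                             ≡⟨ eq ⟩
      reverse (factor u i (a ℕ.+ b))                   ≡⟨ cong reverse (factor-++ i a b) ⟩
      reverse (factor u i a ++ factor u (i ℕ.+ a) b)   ≡⟨ reverse-++ (factor u i a) _ ⟩
      reverse (factor u (i ℕ.+ a) b) ++ reverse (factor u i a) ∎))
    where open ≡-Reasoning

  -- Occurrences and first occurrences.

  OccursAt : List (Fin k) → ℕ → Set
  OccursAt w i = factor u i (length w) ≡ w

  factor-occurs : ∀ i n → OccursAt (factor u i n) i
  factor-occurs i n = cong (factor u i) (length-factor i n)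

  FirstAt : List (Fin k) → ℕ → Set
  FirstAt w = Least (OccursAt w)

  _≟ʷ_ : DecidableEquality (List (Fin k))
  _≟ʷ_ = ≡-dec Fin._≟_

  firstOccurrence : ∀ {w i} → OccursAt w i → ∃ (FirstAt w)
  firstOccurrence {w} = least (λ j → factor u j (length w) ≟ʷ w) _

  FactorOf-prefix⇒occurs : ∀ {w} p → FactorOf w (prefix u p) → ∃[ i ] (OccursAt w i × i ℕ.+ length w ℕ.≤ p)
  FactorOf-prefix⇒occurs {w} p (xs , ys , eq) =
    i , sym w≡ , subst (i ℕ.+ length w ℕ.≤_) (sym p≡)
      (ℕ.≤-trans (ℕ.m≤m+n _ (length ys)) (ℕ.≤-reflexive (ℕ.+-assoc i _ _)))
    where
    i = length xs
    p≡ : p ≡ i ℕ.+ (length w ℕ.+ length ys)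
    p≡ = trans (sym (length-factor 0 p)) (trans (cong length (sym eq))
      (trans (length-++ xs) (cong (i ℕ.+_) (length-++ w))))
    eq₁ : w ++ ys ≡ factor u i (length w ℕ.+ length ys)
    eq₁ = proj₂ (++-injective xs (factor u 0 i) (sym (length-factor 0 i))
      (trans eq (trans (cong (factor u 0) p≡) (factor-++ 0 i _))))
    w≡ : w ≡ factor u i (length w)
    w≡ = proj₁ (++-injective w (factor u i (length w)) (sym (length-factor i _))
      (trans eq₁ (factor-++ i (length w) (length ys))))

  occurs⇒FactorOf-prefix : ∀ {w i} p → OccursAt w i → i ℕ.+ length w ℕ.≤ p → FactorOf w (prefix u p)
  occurs⇒FactorOf-prefix {w} {i} p occ i+w≤p =
    factor u 0 i , factor u (i ℕ.+ length w) r , sym (begin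
      factor u 0 p                                        ≡⟨ cong (factor u 0) p≡ ⟩
      factor u 0 (i ℕ.+ (length w ℕ.+ r))                 ≡⟨ factor-++ 0 i _ ⟩
      factor u 0 i ++ factor u i (length w ℕ.+ r)         ≡⟨ cong (factor u 0 i ++_) (factor-++ i (length w) r) ⟩
      factor u 0 i ++ factor u i (length w) ++ factor u (i ℕ.+ length w) r
        ≡⟨ cong (λ v → factor u 0 i ++ v ++ factor u (i ℕ.+ length w) r) occ ⟩
      factor u 0 i ++ w ++ factor u (i ℕ.+ length w) r    ∎)
    where
    open ≡-Reasoning
    r = p ℕ.∸ (i ℕ.+ length w)
    p≡ : p ≡ i ℕ.+ (length w ℕ.+ r)
    p≡ = trans (sym (ℕ.m+[n∸m]≡n i+w≤p)) (ℕ.+-assoc i (length w) r)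

  -- The end `e` is exclusive: `e ≤ m` says that the first occurrence lies inside `prefix u m`.
  NewPalindromeAt : List (Fin k) → ℕ → Set
  NewPalindromeAt q e = IsPalindrome q × ∃[ i ] (i ℕ.+ length q ≡ e × FirstAt q i)

  -- The classical fact that appending a letter completes at most one new palindrome: `q` is a
  -- suffix of the occurrence of `q′`, and the symmetry of `q′` moves it to the start `j` of that
  -- occurrence. If `q` were strictly shorter, it would occur before its first occurrence.
  newPalindrome-unique-≤ : ∀ {q q′ e} → length q ℕ.≤ length q′ →
    NewPalindromeAt q e → NewPalindromeAt q′ e → q ≡ q′
  newPalindrome-unique-≤ {q} {q′} {e} q≤q′ (pal , i , i+q≡e , occ , first) (pal′ , j , j+q′≡e , occ′ , _) =
    conclude (ℕ.m≤n⇒m<n∨m≡n j≤i)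
    where
    d = length q′ ℕ.∸ length q
    d+q : d ℕ.+ length q ≡ length q′
    d+q = ℕ.m∸n+n≡m q≤q′
    i≡j+d : i ≡ j ℕ.+ d
    i≡j+d = ℕ.+-cancelʳ-≡ (length q) i (j ℕ.+ d) (trans i+q≡e (trans (sym j+q′≡e)
      (trans (cong (j ℕ.+_) (sym d+q)) (sym (ℕ.+-assoc j d _)))))
    j≤i : j ℕ.≤ i
    j≤i = subst (j ℕ.≤_) (sym i≡j+d) (ℕ.m≤m+n j d)
    occ″ : factor u j (d ℕ.+ length q) ≡ q′
    occ″ = trans (cong (factor u j) d+q) occ′
    occ-j : OccursAt q j
    occ-j = begin
      factor u j (length q)                   ≡⟨ factor-mirror j j d _ (trans occ″ (trans (sym pal′) (cong reverse (sym occ″)))) ⟩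
      reverse (factor u (j ℕ.+ d) (length q)) ≡⟨ cong (λ n → reverse (factor u n (length q))) i≡j+d ⟨
      reverse (factor u i (length q))         ≡⟨ cong reverse occ ⟩
      reverse q                               ≡⟨ pal ⟩
      q                                       ∎
      where open ≡-Reasoning
    conclude : j ℕ.< i ⊎ j ≡ i → q ≡ q′
    conclude (inj₁ j<i)  = contradiction occ-j (first j<i)
    conclude (inj₂ refl) = trans (sym occ)
      (trans (cong (factor u i) (ℕ.+-cancelˡ-≡ i _ _ (trans i+q≡e (sym j+q′≡e)))) occ′)

  newPalindrome-unique : ∀ {q q′ e} → NewPalindromeAt q e → NewPalindromeAt q′ e → q ≡ q′
  newPalindrome-unique {q} {q′} n n′ with ℕ.≤-total (length q) (length q′)
  ... | inj₁ le = newPalindrome-unique-≤ le n n′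
  ... | inj₂ ge = sym (newPalindrome-unique-≤ ge n′ n)

  -- Windows of length `N` and the palindromes that end with them.

  module _ (N : ℕ) where

    window : ℕ → List (Fin k)
    window j = factor u j N

    open Orbits _≟ʷ_ reverse reverse-involutive window

    -- `q` is the suffix of window `j` that starts at `j + a`. An earlier equal window `j′` contains
    -- `q` at `j′ + a`; an earlier window `j′` that is the reversal of window `j` begins with
    -- `reverse q`, which is `q`. Both positions precede the first occurrence.
    shortNewPalindrome⇒fresh : ∀ {q} j → length q ℕ.≤ N → NewPalindromeAt q (j ℕ.+ N) → ¬ Stale j
    shortNewPalindrome⇒fresh {q} j q≤N (pal , i , i+q≡ , occ , first) = λ
      { (j′ , j′<j , inj₁ eq) →
          first (subst (j′ ℕ.+ a ℕ.<_) (sym i≡j+a) (ℕ.+-monoˡ-< a j′<j))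
            (trans (sym (factor-suffix j j′ a (length q) (along eq))) occ-j+a)
      ; (j′ , j′<j , inj₂ eq) →
          first (subst (j′ ℕ.<_) (sym i≡j+a) (ℕ.≤-trans j′<j (ℕ.m≤m+n j a)))
            (trans (factor-mirror j j′ a (length q)
                     (trans (sym (reverse-involutive _)) (cong reverse (sym (along-reverse eq)))))
              (trans (cong reverse occ-j+a) pal)) }
      where
      a = N ℕ.∸ length q
      a+q : a ℕ.+ length q ≡ N
      a+q = ℕ.m∸n+n≡m q≤N
      i≡j+a : i ≡ j ℕ.+ a
      i≡j+a = ℕ.+-cancelʳ-≡ (length q) i (j ℕ.+ a) (trans i+q≡
        (trans (cong (j ℕ.+_) (sym a+q)) (sym (ℕ.+-assoc j a _))))
      occ-j+a : OccursAt q (j ℕ.+ a)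
      occ-j+a = subst (OccursAt q) i≡j+a occ
      along : ∀ {j j′} → window j ≡ window j′ →
        factor u j (a ℕ.+ length q) ≡ factor u j′ (a ℕ.+ length q)
      along {j} {j′} = subst (λ n → factor u j n ≡ factor u j′ n) (sym a+q)
      along-reverse : ∀ {j j′} → window j ≡ reverse (window j′) →
        factor u j (a ℕ.+ length q) ≡ reverse (factor u j′ (a ℕ.+ length q))
      along-reverse {j} {j′} = subst (λ n → factor u j n ≡ reverse (factor u j′ n)) (sym a+q)

    longPalindrome⇒stale : ∀ {q i} → IsPalindrome q → OccursAt q i → N ℕ.< length q →
      ∃[ j ] (j ℕ.+ N ≡ i ℕ.+ length q × Stale j)
    longPalindrome⇒stale {q} {i} pal occ N<q =
      i ℕ.+ a , trans (ℕ.+-assoc i a N) (cong (i ℕ.+_) a+N) ,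
      -- The symmetry of `q` exchanges its first window, at `i`, with the reversal of its last one,
      -- at `i + a`; `a` is positive because `q` is strictly longer than `N`.
      i , ℕ.m<m+n i (ℕ.m<n⇒0<n∸m N<q) , inj₂ (trans (sym (reverse-involutive _))
        (cong reverse (sym (factor-mirror i i a N (trans occ′ (trans (sym pal) (cong reverse (sym occ′))))))))
      where
      a = length q ℕ.∸ N
      a+N : a ℕ.+ N ≡ length q
      a+N = ℕ.m∸n+n≡m (ℕ.<⇒≤ N<q)
      occ′ : factor u i (a ℕ.+ N) ≡ q
      occ′ = trans (cong (factor u i) a+N) occ

    -- A palindrome is charged either to itself or to the start of the window of length N at whose
    -- end it first occurs.
    Charge : List (Fin k) → List (Fin k) ⊎ ℕ → Set
    Charge w (inj₁ q) = w ≡ q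
    Charge w (inj₂ j) = NewPalindromeAt w (j ℕ.+ N)

    Charge-injective : ∀ {w w′ y} → Charge w y → Charge w′ y → w ≡ w′
    Charge-injective {y = inj₁ q} w≡q w′≡q = trans w≡q (sym w′≡q)
    Charge-injective {y = inj₂ j} new new′ = newPalindrome-unique new new′

-- Closed form of the partial sums of `T`.

cumulative : (ℕ → ℕ) → ℕ → ℕ
cumulative P zero    = P 0
cumulative P (suc n) = P (suc n) ℕ.+ cumulative P n

cumulative-count : ∀ {k} (u : Word k) {P} → IsPalindromicComplexity u P → ∀ n →
  IsCount (λ w → length w ℕ.≤ n × IsPalindrome w × w ∈L u) (cumulative P n)
cumulative-count u isP zero = IsCount-cong
  (λ { (len , w) → ℕ.≤-reflexive len , w }) (λ { (len , w) → ℕ.n≤0⇒n≡0 len , w }) (isP 0)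
cumulative-count u isP (suc n) = IsCount-cong
  [ (λ { (len , w) → ℕ.≤-reflexive len , w }) , (λ { (len , w) → ℕ.m≤n⇒m≤1+n len , w }) ]′
  (λ { (len , w) → [ (λ len< → inj₂ (ℕ.s≤s⁻¹ len< , w)) , (λ len≡ → inj₁ (len≡ , w)) ]′
                     (ℕ.m≤n⇒m<n∨m≡n len) })
  (IsCount-⊎ (isP (suc n)) (cumulative-count u isP n)
    (λ { (len≡ , _) (len≤ , _) → ℕ.<⇒≢ (s≤s len≤) len≡ }))

-- The differences of `C` telescope, and doubling `cumulative P N` counts `P 0` and `P N` once too
-- often; the term `+ P N` corrects one of these, and the other cancels against `C 0`.
partialSum-T : ∀ C P → C 0 ≡ P 0 → ∀ N → partialSum (T C P) N ≡
  (+ C N ℤ.+ + P N ℤ.+ + 2 * + N) ℤ.- + 2 * + cumulative P N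
partialSum-T C P C₀≡P₀ zero = trans (zero-case (+ P 0))
  (cong (λ c → (+ c ℤ.+ + P 0 ℤ.+ + 2 * + 0) ℤ.- + 2 * + P 0) (sym C₀≡P₀))
  where
  zero-case : ∀ p → + 0 ≡ (p ℤ.+ p ℤ.+ + 2 * + 0) ℤ.- + 2 * p
  zero-case = ℤ-Solver.solve-∀
partialSum-T C P C₀≡P₀ (suc N) = trans (cong (ℤ._+ T C P N) (partialSum-T C P C₀≡P₀ N))
  (suc-case (+ C N) (+ C (suc N)) (+ P N) (+ P (suc N)) (+ N) (+ cumulative P N))
  where
  suc-case : ∀ c c′ p p′ n s →
    ((c ℤ.+ p ℤ.+ + 2 * n) ℤ.- + 2 * s) ℤ.+ (((c′ ℤ.- c ℤ.+ + 2) ℤ.- p′) ℤ.- p)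
    ≡ (c′ ℤ.+ p′ ℤ.+ + 2 * (+ 1 ℤ.+ n)) ℤ.- + 2 * (p′ ℤ.+ s)
  suc-case = ℤ-Solver.solve-∀

-- Comparison of the defect with the partial sums.

module _ {k} (u : Word k) (closed : ClosedUnderReversal u) {C P Q : ℕ → ℕ}
  (isC : IsFactorComplexity u C) (isP : IsPalindromicComplexity u P) (isQ : IsPrefixPalCount u Q)
  where

  module _ (N : ℕ) where
    open Orbits (_≟ʷ_ u) reverse reverse-involutive (window u N)
    open Census

    -- Closure under reversal enters here: it makes the reversed windows factors as well.
    window∈L : ∀ {x M} → ∃[ i ] (i ℕ.< M × (x ≡ window u N i ⊎ x ≡ reverse (window u N i))) →
      length x ≡ N × x ∈L u
    window∈L (i , _ , inj₁ refl) = length-factor u i N , i , factor-occurs u i N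
    window∈L (i , _ , inj₂ refl) = trans (length-reverse (window u N i)) (length-factor u i N) ,
      closed _ (i , factor-occurs u i N)

    2*fresh≤C+P : ∀ {M} (c : Census M) → 2 ℕ.* length (fresh c) ℕ.≤ C N ℕ.+ P N
    2*fresh≤C+P c = subst (ℕ._≤ C N ℕ.+ P N) (orbits+fixed c) (ℕ.+-mono-≤ orbits≤ fixed≤)
      where
      orbits≤ : length (orbits c) ℕ.≤ C N
      orbits≤ = IsCount-≥ (isC N) (orbits-unique c) (λ x∈ → window∈L (orbits-sound c x∈))
      fixed≤ : length (fixed c) ℕ.≤ P N
      fixed≤ = IsCount-≥ (isP N) (fixed-unique c)
        (λ x∈ → let pal , x∈orbits = fixed-sound c x∈
                    len , x∈L = window∈L (orbits-sound c x∈orbits)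
                in len , pal , x∈L)

    -- The finitely many factors of length `N` all have occurrences starting below some `M`, so the
    -- census misses none. It covers `suc M` positions because these are exactly the starts of the
    -- windows inside the prefix of length `M + N`.
    ∃-C+P≤2*fresh : ∃[ M ] (∀ (c : Census (suc M)) → C N ℕ.+ P N ℕ.≤ 2 ℕ.* length (fresh c))
    ∃-C+P≤2*fresh with isC N
    ... | xs , _ , _ , xs⇔
      with commonBound (λ w i → window u N i ≡ w) xs
        (λ {w} w∈ → let len , i , occ = Equivalence.to (xs⇔ w) w∈
                    in i , trans (cong (factor u i) (sym len)) occ)
    ... | M , starts = M , λ c → subst (C N ℕ.+ P N ℕ.≤_) (orbits+fixed c) (ℕ.+-mono-≤
        (IsCount-≤ (orbits c) (isC N) (λ {w} (len , w∈L) →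
          let i , i<M , eq = starts (Equivalence.from (xs⇔ w) (len , w∈L))
          in subst (_∈ orbits c) eq (orbits-complete c (ℕ.m<n⇒m<1+n i<M))))
        (IsCount-≤ (fixed c) (isP N) (λ {w} (len , pal , w∈L) →
          let i , i<M , eq = starts (Equivalence.from (xs⇔ w) (len , w∈L))
          in subst (_∈ fixed c) eq (fixed-complete c (ℕ.m<n⇒m<1+n i<M)
               (trans (cong reverse eq) (trans pal (sym eq)))))))

  module _ (p : ℕ) where
    open Orbits (_≟ʷ_ u) reverse reverse-involutive (window u (suc p))
    open Census

    -- Palindromes in the prefix of length `p` are charged to themselves, the others to the fresh
    -- windows of length `suc p` at whose ends they first occur.
    shortPalindromes≤ : 2 ℕ.* cumulative P (suc p) ℕ.≤ (C (suc p) ℕ.+ P (suc p)) ℕ.+ 2 ℕ.* Q p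
    shortPalindromes≤ with cumulative-count u isP (suc p) | isQ p
    ... | xs , lenxs , uniq , xs⇔ | qs , lenqs , _ , qs⇔
      with commonBound (NewPalindromeAt u) xs
        (λ {w} w∈ → let _ , pal , _ , occ = Equivalence.to (xs⇔ w) w∈
                        i , first = firstOccurrence u occ
                    in _ , pal , i , refl , first)
    -- `M` exceeds the ends of the first occurrences of all palindromes in `xs`, so the census
    -- reaches every charged position.
    ... | M , ends = begin
        2 ℕ.* cumulative P (suc p)                      ≡⟨ cong (2 ℕ.*_) lenxs ⟨
        2 ℕ.* length xs                                 ≤⟨ ℕ.*-monoʳ-≤ 2 (length-≤-via (Charge u (suc p)) (Charge-injective u (suc p)) _ uniq charge) ⟩
        2 ℕ.* length (map inj₁ qs ++ map inj₂ (fresh c)) ≡⟨ cong (2 ℕ.*_) (length-++ (map inj₁ qs)) ⟩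
        2 ℕ.* (length (map {B = List (Fin k) ⊎ ℕ} inj₁ qs) ℕ.+ length (map {B = List (Fin k) ⊎ ℕ} inj₂ (fresh c)))
          ≡⟨ cong₂ (λ a b → 2 ℕ.* (a ℕ.+ b)) (trans (length-map inj₁ qs) lenqs) (length-map inj₂ (fresh c)) ⟩
        2 ℕ.* (Q p ℕ.+ length (fresh c))                ≡⟨ ℕ.*-distribˡ-+ 2 (Q p) _ ⟩
        2 ℕ.* Q p ℕ.+ 2 ℕ.* length (fresh c)            ≤⟨ ℕ.+-monoʳ-≤ (2 ℕ.* Q p) (2*fresh≤C+P (suc p) c) ⟩
        2 ℕ.* Q p ℕ.+ (C (suc p) ℕ.+ P (suc p))         ≡⟨ ℕ.+-comm (2 ℕ.* Q p) _ ⟩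
        (C (suc p) ℕ.+ P (suc p)) ℕ.+ 2 ℕ.* Q p         ∎
      where
      open ℕ.≤-Reasoning
      c = census M

      charge : ∀ {w} → w ∈ xs → ∃[ y ] (y ∈ map inj₁ qs ++ map inj₂ (fresh c) × Charge u (suc p) w y)
      charge {w} w∈ with ends w∈ | Equivalence.to (xs⇔ w) w∈
      ... | e , e<M , new@(pal , i , i+w≡e , occ , _) | w≤ , _ with e ℕ.≤? p
      ... | yes e≤p = inj₁ w , ∈-++⁺ˡ (∈-map⁺ inj₁ (Equivalence.from (qs⇔ w)
              (pal , occurs⇒FactorOf-prefix u p occ (subst (ℕ._≤ p) (sym i+w≡e) e≤p)))) , refl
      -- Here `e` is at least `suc p`, so a full window of length `suc p` ends at `e` and the
      -- truncated subtraction in `j` is exact.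
      ... | no e≰p  = inj₂ j , ∈-++⁺ʳ (map inj₁ qs) (∈-map⁺ inj₂ (fresh-complete c
              (ℕ.≤-<-trans (ℕ.m∸n≤m e (suc p)) e<M)
              (shortNewPalindrome⇒fresh u (suc p) j w≤ new′))) , new′
        where
        j = e ℕ.∸ suc p
        new′ : NewPalindromeAt u w (j ℕ.+ suc p)
        new′ = subst (NewPalindromeAt u w) (sym (ℕ.m∸n+n≡m (ℕ.≰⇒> e≰p))) new

  module _ (N : ℕ) where
    open Orbits (_≟ʷ_ u) reverse reverse-involutive (window u N)
    open Census

    prefixPalindromes≤ : ∀ {M} (c : Census (suc M)) →
      Q (M ℕ.+ N) ℕ.≤ cumulative P N ℕ.+ length (stale c)
    prefixPalindromes≤ {M} c with cumulative-count u isP N | isQ (M ℕ.+ N)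
    ... | xs , lenxs , _ , xs⇔ | qs , lenqs , uniq , qs⇔ =
      subst₂ ℕ._≤_ lenqs
        (trans (length-++ (map inj₁ xs)) (cong₂ ℕ._+_ (trans (length-map inj₁ xs) lenxs) (length-map inj₂ (stale c))))
        (length-≤-via (Charge u N) (Charge-injective u N) _ uniq charge)
      where
      charge : ∀ {w} → w ∈ qs → ∃[ y ] (y ∈ map inj₁ xs ++ map inj₂ (stale c) × Charge u N w y)
      charge {w} w∈ with Equivalence.to (qs⇔ w) w∈
      ... | pal , w-in-prefix with FactorOf-prefix⇒occurs u (M ℕ.+ N) w-in-prefix | length w ℕ.≤? N
      ... | i , occ , _ | yes w≤N =
            inj₁ w , ∈-++⁺ˡ (∈-map⁺ inj₁ (Equivalence.from (xs⇔ w) (w≤N , pal , i , occ))) , refl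
      -- The first occurrence starts no later than the one found in the prefix, so its last window
      -- starts at `M` at the latest, and the census over `suc M` positions includes `M`.
      ... | i , occ , i+w≤ | no w≰N with firstOccurrence u occ
      ... | i₀ , first@(occ₀ , before) with longPalindrome⇒stale u N pal occ₀ (ℕ.≰⇒> w≰N)
      ... | j , j+N≡ , j-stale =
            inj₂ j , ∈-++⁺ʳ (map inj₁ xs) (∈-map⁺ inj₂ (stale-complete c (s≤s j≤M) j-stale)) ,
            pal , i₀ , sym j+N≡ , first
        where
        i₀≤i : i₀ ℕ.≤ i
        i₀≤i = ℕ.≮⇒≥ λ i<i₀ → before i<i₀ occ
        j≤M : j ℕ.≤ M
        j≤M = ℕ.+-cancelʳ-≤ N j M (subst (ℕ._≤ M ℕ.+ N) (sym j+N≡)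
          (ℕ.≤-trans (ℕ.+-monoˡ-≤ (length w) i₀≤i) i+w≤))

  C₀≡P₀ : C 0 ≡ P 0
  C₀≡P₀ = ℕ.≤-antisym
    (IsCount-mono (isC 0) (isP 0) (λ { {[]} (len , w∈L) → len , refl , w∈L }))
    (IsCount-mono (isP 0) (isC 0) (λ { (len , _ , w∈L) → len , w∈L }))

  -- With windows of length `suc p`, the term `suc p` of the defect is the `N` of the closed form,
  -- and the claim is `shortPalindromes≤` rearranged.
  2*prefixDefect≤partialSum : ∀ p → + 2 * prefixDefect Q p ≤ partialSum (T C P) (suc p)
  2*prefixDefect≤partialSum p = subst₂ _≤_
    (lhs (+ cumulative P N) (+ N) (+ Q p))
    (trans (rhs (+ C N) (+ P N) (+ cumulative P N) (+ N) (+ Q p)) (sym (partialSum-T C P C₀≡P₀ N)))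
    (ℤ.+-monoˡ-≤ _ (subst₂ _≤_ (ℤ.pos-* 2 (cumulative P N)) (cong (λ z → + (C N ℕ.+ P N) ℤ.+ z) (ℤ.pos-* 2 (Q p)))
      (+≤+ (shortPalindromes≤ p))))
    where
    N = suc p
    lhs : ∀ s n q → + 2 * s ℤ.+ (+ 2 * n ℤ.- + 2 * q ℤ.- + 2 * s) ≡ + 2 * (n ℤ.- q)
    lhs = ℤ-Solver.solve-∀
    rhs : ∀ c p s n q → (c ℤ.+ p ℤ.+ + 2 * q) ℤ.+ (+ 2 * n ℤ.- + 2 * q ℤ.- + 2 * s)
      ≡ (c ℤ.+ p ℤ.+ + 2 * n) ℤ.- + 2 * s
    rhs = ℤ-Solver.solve-∀

  -- For the prefix of length `M + N` the defect is `suc M + N - Q (M + N)`. Of the `suc M`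
  -- positions, twice the number of fresh ones is at least `C N + P N`, and the stale ones pay for
  -- the palindromes longer than `N`.
  ∃-partialSum≤2*prefixDefect : ∀ N → ∃[ p ] partialSum (T C P) N ≤ + 2 * prefixDefect Q p
  ∃-partialSum≤2*prefixDefect N = M ℕ.+ N , subst₂ _≤_
    (trans (lhs (+ C N) (+ P N) (+ cumulative P N) (+ N) (+ Q (M ℕ.+ N))) (sym (partialSum-T C P C₀≡P₀ N)))
    (rhs (+ suc M) (+ cumulative P N) (+ N) (+ Q (M ℕ.+ N)))
    (ℤ.+-monoˡ-≤ _ (subst₂ _≤_ (cong (λ z → + (C N ℕ.+ P N) ℤ.+ z) (ℤ.pos-* 2 (Q (M ℕ.+ N))))
      (cong₂ ℤ._+_ (ℤ.pos-* 2 (suc M)) (ℤ.pos-* 2 (cumulative P N)))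
      (+≤+ bound)))
    where
    open Orbits (_≟ʷ_ u) reverse reverse-involutive (window u N)
    open Census
    M = proj₁ (∃-C+P≤2*fresh N)
    c = census (suc M)

    regroup : ∀ f s t → 2 ℕ.* f ℕ.+ 2 ℕ.* (t ℕ.+ s) ≡ 2 ℕ.* (f ℕ.+ s) ℕ.+ 2 ℕ.* t
    regroup = ℕ-Solver.solve-∀

    bound : (C N ℕ.+ P N) ℕ.+ 2 ℕ.* Q (M ℕ.+ N) ℕ.≤ 2 ℕ.* suc M ℕ.+ 2 ℕ.* cumulative P N
    bound = begin
      (C N ℕ.+ P N) ℕ.+ 2 ℕ.* Q (M ℕ.+ N)
        ≤⟨ ℕ.+-mono-≤ (proj₂ (∃-C+P≤2*fresh N) c) (ℕ.*-monoʳ-≤ 2 (prefixPalindromes≤ N c)) ⟩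
      2 ℕ.* length (fresh c) ℕ.+ 2 ℕ.* (cumulative P N ℕ.+ length (stale c))
        ≡⟨ regroup (length (fresh c)) (length (stale c)) (cumulative P N) ⟩
      2 ℕ.* (length (fresh c) ℕ.+ length (stale c)) ℕ.+ 2 ℕ.* cumulative P N
        ≡⟨ cong (λ z → 2 ℕ.* z ℕ.+ 2 ℕ.* cumulative P N) (fresh+stale c) ⟩
      2 ℕ.* suc M ℕ.+ 2 ℕ.* cumulative P N ∎
      where open ℕ.≤-Reasoning

    lhs : ∀ c p s n q → (c ℤ.+ p ℤ.+ + 2 * q) ℤ.+ (+ 2 * n ℤ.- + 2 * q ℤ.- + 2 * s)
      ≡ (c ℤ.+ p ℤ.+ + 2 * n) ℤ.- + 2 * s
    lhs = ℤ-Solver.solve-∀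
    rhs : ∀ m s n q → (+ 2 * m ℤ.+ + 2 * s) ℤ.+ (+ 2 * n ℤ.- + 2 * q ℤ.- + 2 * s)
      ≡ + 2 * ((m ℤ.+ n) ℤ.- q)
    rhs = ℤ-Solver.solve-∀

-- Equality of two possibly infinite suprema is expressed by their lower bounds: a natural number is
-- reached on one side exactly when it is reached on the other. Since `T` is nonnegative for a
-- language closed under reversal, the infinite sum is the supremum of its partial sums.
theorem4p1 : ∀ {k} (u : Word k) → UniformlyRecurrent u → ClosedUnderReversal u →
    (C P Q : ℕ → ℕ) → IsFactorComplexity u C → IsPalindromicComplexity u P →
    IsPrefixPalCount u Q →
    ∀ (m : ℕ) →
    (∃[ p ] + m ≤ + 2 * prefixDefect Q p) ⇔ (∃[ N ] + m ≤ partialSum (T C P) N)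
theorem4p1 u _ closed C P Q isC isP isQ m = mk⇔
  (λ { (p , m≤) → suc p , ℤ.≤-trans m≤ (2*prefixDefect≤partialSum u closed isC isP isQ p) })
  (λ { (N , m≤) → let p , ≤p = ∃-partialSum≤2*prefixDefect u closed isC isP isQ N
                  in p , ℤ.≤-trans m≤ ≤p })
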